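{- Let $p/q$ be a rational number in lowest terms, let $m\ge 0$ be an integer, and let $(u_n)_{n\ge1}$ be an arbitrary sequence of positive integers. Write $p/q=[a_0;a_1,\dots,a_{2k+1}]$ as a finite continued fraction whose last partial quotient has odd index $2k+1$, and let $q_{2k}$ be the denominator of its $2k$th convergent. Suppose $x_1=q>1$, and let $\alpha$ be given by the series $$\alpha=\frac pq-\sum_{j=2}^\infty\frac{(-1)^j}{x_j},$$ where $(x_n)_{n\ge1}$, together with $(y_n)_{n\ge0}$, is defined by $$y_j=y_{j-1}(1+u_jx_j),\qquad x_{j+1}=x_jy_j,\qquad j\ge 1,$$ with $$x_1=q,\qquad y_0=mq+q_{2k}-1,$$ and where the restriction $m\ge1$ is imposed if $q_{2k}=1$. Then the continued fraction expansion of $\alpha$ has the form $\alpha=[a_0;a_1,a_2,\dots]$, where the partial quotients $a_j$ coincide with those of $p/q=[a_0;a_1,\dots,a_{2k+1}]$ for $0\le j\le 2k+1$, while $$a_{2k+2}=m+u_1y_0-1,$$ and $$a_{2k+3j}=1,\qquad a_{2k+3j+1}=x_j-1,\qquad a_{2k+3j+2}=u_{j+1}y_j-1\qquad\text{for all } j\ge 1,$$ with the denominators $q_n$ of the convergents being given by $$q_{2k+3j-2}=x_j,\qquad q_{2k+3j-1}=y_j-x_j+1,\qquad q_{2k+3j}=y_j+1\qquad\text{for all } j\ge1.$$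
   Context: Continued fractions: $[a_0;a_1,\dots,a_n]=a_0+\cfrac{1}{a_1+\cfrac{1}{\cdots+\cfrac1{a_n}}}=p_n/q_n$ with $a_0\in\mathbb Z$, $a_j\in\mathbb Z_{>0}$ for $j\ge1$, and $p_n/q_n$ in lowest terms with $q_n>0$; an infinite continued fraction is $[a_0;a_1,a_2,\dots]=\lim_{n\to\infty}[a_0;a_1,\dots,a_n]$. The numerators and denominators of the convergents $p_n/q_n$ satisfy $p_{n+1}=a_{n+1}p_n+p_{n-1}$, $q_{n+1}=a_{n+1}q_n+q_{n-1}$ for $n\ge -1$, with $p_{ -1}=1$, $p_{ -2}=0$, $q_{ -1}=0$, $q_{ -2}=1$. Every rational number has a finite continued fraction whose last index is odd, because $[a_0;\dots,a_j]=[a_0;\dots,a_j-1,1]$ if $j=0$ or $a_j>1$, and $[a_0;\dots,a_{j-1},1]=[a_0;\dots,a_{j-1}+1]$.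
   Formalization: If m=0, u_1=1, q_{2k}=2 (e.g. p/q=2/3=[0;1,1,1]), then y_0=1 and a_{2k+2}=0 is not a positive partial quotient; in that case only, positivity of a_{2k+2} and the formula for q_{2k+2} are not asserted; all other claims remain. -}

module Defs where

open import Data.Integer as ℤ using (ℤ; +0; +[1+_]; -[1+_])
open import Data.Nat as ℕ using (ℕ; zero; suc)
open import Data.Product using (∃-syntax)
open import Data.Rational
open import Relation.Binary.PropositionalEquality using (_≡_)

------------------------------------------------------------------------
-- Real numbers, represented by Cauchy sequences of rationals

record ℝ : Set where
  field
    approx : ℕ → ℚ
    cauchy : ∀ ε → 0ℚ < ε →
             ∃[ N ] (∀ i j → N ℕ.≤ i → N ℕ.≤ j → ∣ approx i - approx j ∣ < ε)

open ℝ public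

-- The relation |r - α| ≤ ε between real numbers.  The slack δ is needed
-- because α is only the limit of its approximations.

Within : ℚ → ℝ → ℚ → Set
Within r α ε = ∀ δ → 0ℚ < δ →
               ∃[ M ] (∀ i → M ℕ.≤ i → ∣ r - approx α i ∣ < ε + δ)

infix 4 _⟶_

_⟶_ : (ℕ → ℚ) → ℝ → Set
s ⟶ α = ∀ ε → 0ℚ < ε → ∃[ N ] (∀ n → N ℕ.≤ n → Within (s n) α ε)

------------------------------------------------------------------------
-- Rational arithmetic

fromℤ : ℤ → ℚ
fromℤ i = i / 1

-- Reciprocal, made total by the convention recip 0 = 0.

recip : ℚ → ℚ
recip   (mkℚ +0       _ _) = 0ℚ
recip r@(mkℚ +[1+ _ ] _ _) = 1/ r
recip r@(mkℚ -[1+ _ ] _ _) = 1/ r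

------------------------------------------------------------------------
-- Continued fractions

-- cf a n is the finite continued fraction [a 0; a 1, …, a n]; it depends
-- only on the first n + 1 entries of a.  The junk value of recip at 0 is
-- never used when a j ≥ 0 for 1 ≤ j < n and a n > 0 (or n = 0).
-- Elements of ℚ are stored in lowest terms with positive denominator, so
-- ↧ (cf a n) is the denominator qₙ of the n-th convergent, and
-- cf a ⟶ α says that α = [a 0; a 1, a 2, …].

cf : (ℕ → ℤ) → ℕ → ℚ
cf a zero    = fromℤ (a 0)
cf a (suc n) = fromℤ (a 0) + recip (cf (λ j → a (suc j)) n)

------------------------------------------------------------------------
-- Alternating series of reciprocals

-- (-1)ʲ / xⱼ

term : (ℕ → ℤ) → ℕ → ℚ
term x j = fromℤ (ℤ.-1ℤ ℤ.^ j) * recip (fromℤ (x j))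

-- The sum of the first n terms of f 2 + f 3 + f 4 + ⋯

sumFrom2 : (ℕ → ℚ) → ℕ → ℚ
sumFrom2 f zero    = 0ℚ
sumFrom2 f (suc n) = sumFrom2 f n + f (2 ℕ.+ n)

------------------------------------------------------------------------
-- The degenerate partial quotient

-- With m = 0, u₁ = 1 and q₂ₖ = 2 one has y₀ = 1, so the partial quotient
-- m + u₁y₀ - 1 at index 2k + 2 is 0.  It is then not a positive integer,
-- and the finite continued fraction ending in it is undefined.
-- Degenerate k m u₁ q₂ₖ n says that n is this index in this situation.

record Degenerate (k : ℕ) (m u₁ q₂ₖ : ℤ) (n : ℕ) : Set where
  constructor degenerate
  field
    index : n ≡ 2 ℕ.* k ℕ.+ 2
    m≡0   : m ≡ ℤ.+ 0
    u₁≡1  : u₁ ≡ ℤ.+ 1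
    q₂ₖ≡2 : q₂ₖ ≡ ℤ.+ 2

{-# OPTIONS --safe #-}
module Submission where

-- For n ≥ 0 put w = 2k + 3n + 1.  By induction on n the recurrence for the
-- denominators gives q_w = x_{n+1}, q_{w+1} = y_{n+1} - x_{n+1} + 1 and
-- q_{w+2} = y_{n+1} + 1.  Two convergents three apart satisfy
-- p_{w+3} q_w - p_w q_{w+3} = (a_{w+2} a_{w+3} + 1) (-1)^w = -(-1)^n x_{n+1},
-- and as x_{n+2} = x_{n+1} y_{n+1} their difference is exactly the next term
-- of the series.  So the partial sums are the convergents with index w, and
-- the two convergents in between lie within 1 / x_{n+1} of them.

-- The function `cf` unfolds from the first partial quotient, whereas the recurrences act at the
-- last one; the integer sequences `P` and `Q` have to be reconciled with both. As `↧` reads the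
-- denominator of a reduced fraction, coprimality is needed too, and the determinant supplies it.
-- The delicate index is 2k + 2, whose partial quotient is 0 when m = 0, u₁ = 1 and q₂ₖ = 2. The
-- recurrences and determinants do not notice a zero, and `cf` takes a junk value only when the zero
-- is the last entry. So every other convergent keeps its formula, and the limit is unaffected.

open import Defs
open import Data.Nat using (ℕ; zero; suc; _+_; _*_; _∸_; _≤_; _<_; z≤n; s≤s)
open import Data.Integer as ℤ using (ℤ; 0ℤ; 1ℤ; -1ℤ; +[1+_]; -[1+_]; ∣_∣)
open import Data.Rational as ℚ using (ℚ; ↥_; ↧_; ↧ₙ_; 0ℚ; 1ℚ; mkℚ)
open import Data.Product using (_×_; ∃-syntax; _,_; proj₁; proj₂)
open import Data.Sum using (_⊎_; inj₁; inj₂)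
open import Function using (_∘_)
open import Relation.Binary.PropositionalEquality
open import Relation.Nullary using (¬_; yes; no; contradiction)
import Data.Nat.Properties as ℕ
import Data.Integer.Properties as ℤ
import Data.Rational.Properties as ℚ
import Data.Rational.Unnormalised as ℚᵘ
import Data.Rational.Unnormalised.Properties as ℚᵘ
open import Data.Rational.Solver using (module +-*-Solver)
open import Data.Integer.Tactic.RingSolver using (solve-∀)
open import Data.Nat.Coprimality as Coprimality using (1-coprimeTo)
import Data.Nat.Divisibility as ℕ
import Data.Integer.Divisibility.Signed as ℤˢ
import Data.Integer.Coprimality as ℤ

-- fromℤ i normalises by a gcd and is stuck on an open i, while i /1 computes.
_/1 : ℤ → ℚ
i /1 = mkℚ i 0 (Coprimality.sym (1-coprimeTo ∣ i ∣))

fromℤ≡/1 : ∀ i → fromℤ i ≡ i /1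
fromℤ≡/1 i = ℚ.↥p/↧p≡p (i /1)

fromℤ-+ : ∀ i j → fromℤ (i ℤ.+ j) ≡ fromℤ i ℚ.+ fromℤ j
fromℤ-+ i j = sym (trans (cong₂ ℚ._+_ (fromℤ≡/1 i) (fromℤ≡/1 j))
  (cong fromℤ (cong₂ ℤ._+_ (ℤ.*-identityʳ i) (ℤ.*-identityʳ j))))

fromℤ-* : ∀ i j → fromℤ (i ℤ.* j) ≡ fromℤ i ℚ.* fromℤ j
fromℤ-* i j = sym (cong₂ ℚ._*_ (fromℤ≡/1 i) (fromℤ≡/1 j))

fromℤ-neg : ∀ i → fromℤ (ℤ.- i) ≡ ℚ.- fromℤ i
fromℤ-neg i = trans (fromℤ≡/1 (ℤ.- i)) (trans (/1-neg i) (cong ℚ.-_ (sym (fromℤ≡/1 i))))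
  where
  /1-neg : ∀ i → (ℤ.- i) /1 ≡ ℚ.- (i /1)
  /1-neg (ℤ.+ zero) = refl
  /1-neg +[1+ _ ]   = refl
  /1-neg -[1+ _ ]   = refl

fromℤ-mono-≤ : ∀ {i j} → i ℤ.≤ j → fromℤ i ℚ.≤ fromℤ j
fromℤ-mono-≤ {i} {j} i≤j = subst₂ ℚ._≤_ (sym (fromℤ≡/1 i)) (sym (fromℤ≡/1 j))
  (ℚ.*≤* (ℤ.*-monoʳ-≤-nonNeg 1ℤ i≤j))

fromℤ-mono-< : ∀ {i j} → i ℤ.< j → fromℤ i ℚ.< fromℤ j
fromℤ-mono-< {i} {j} i<j = subst₂ ℚ._<_ (sym (fromℤ≡/1 i)) (sym (fromℤ≡/1 j))
  (ℚ.*<* (ℤ.*-monoʳ-<-pos 1ℤ i<j))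

fromℤ-positive : ∀ {i} → 0ℤ ℤ.< i → ℚ.Positive (fromℤ i)
fromℤ-positive 0<i = ℚ.positive (fromℤ-mono-< 0<i)

-- Cross multiplication and reciprocals

fraction-cross : ∀ r {P Q} → r ℚ.* fromℤ Q ≡ fromℤ P → ↥ r ℤ.* Q ≡ P ℤ.* ↧ r
fraction-cross r@(mkℚ _ _ _) {P} {Q} eq = begin
  ↥ r ℤ.* Q                  ≡⟨ sym (ℤ.*-identityʳ _) ⟩
  ↥ r ℤ.* Q ℤ.* 1ℤ           ≡⟨ ℚᵘ.drop-*≡* cross ⟩
  P ℤ.* ℤ.+ (↧ₙ r * 1)       ≡⟨ cong (λ d → P ℤ.* ℤ.+ d) (ℕ.*-identityʳ (↧ₙ r)) ⟩
  P ℤ.* ↧ r                  ∎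
  where
  open ≡-Reasoning
  cross : ℚ.toℚᵘ r ℚᵘ.* ℚ.toℚᵘ (Q /1) ℚᵘ.≃ ℚ.toℚᵘ (P /1)
  cross = ℚᵘ.≃-trans (ℚᵘ.≃-sym (ℚ.toℚᵘ-homo-* r (Q /1)))
    (ℚ.toℚᵘ-cong (trans (cong (r ℚ.*_) (sym (fromℤ≡/1 Q))) (trans eq (fromℤ≡/1 P))))

*-↧ : ∀ r → r ℚ.* fromℤ (↧ r) ≡ fromℤ (↥ r)
*-↧ r@(mkℚ _ _ _) = ℚ.toℚᵘ-injective (ℚᵘ.≃-trans
  (ℚ.toℚᵘ-cong (cong₂ ℚ._*_ (refl {x = r}) (fromℤ≡/1 (↧ r))))
  (ℚᵘ.≃-trans (ℚ.toℚᵘ-homo-* r ((↧ r) /1))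
  (ℚᵘ.≃-trans (ℚᵘ.*≡* (trans (ℤ.*-identityʳ _)
    (cong (λ d → ↥ r ℤ.* ℤ.+ d) (sym (ℕ.*-identityʳ (↧ₙ r))))))
  (ℚ.toℚᵘ-cong (sym (fromℤ≡/1 (↥ r)))))))

recip-inverseˡ : ∀ r → r ≢ 0ℚ → recip r ℚ.* r ≡ 1ℚ
recip-inverseˡ r@(mkℚ (ℤ.+ zero) _ _) r≢0 = contradiction (ℚ.↥p≡0⇒p≡0 r refl) r≢0
recip-inverseˡ r@(mkℚ +[1+ _ ] _ _)   _   = ℚ.*-inverseˡ r
recip-inverseˡ r@(mkℚ -[1+ _ ] _ _)   _   = ℚ.*-inverseˡ r

fromℤ≢0 : ∀ {i} → 0ℤ ℤ.< i → fromℤ i ≢ 0ℚ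
fromℤ≢0 0<i = ℚ.<⇒≢ (fromℤ-mono-< 0<i) ∘ sym

recip-fromℤ : ∀ {i} → 0ℤ ℤ.< i → recip (fromℤ i) ℚ.* fromℤ i ≡ 1ℚ
recip-fromℤ {i} 0<i = recip-inverseˡ (fromℤ i) (fromℤ≢0 0<i)

*≤1⇒≤recip : ∀ {i z} → 0ℤ ℤ.< i → z ℚ.* fromℤ i ℚ.≤ 1ℚ → z ℚ.≤ recip (fromℤ i)
*≤1⇒≤recip {i} {z} 0<i le = ℚ.*-cancelʳ-≤-pos (fromℤ i) {{fromℤ-positive 0<i}}
  (subst (z ℚ.* fromℤ i ℚ.≤_) (sym (recip-fromℤ 0<i)) le)

recip-nonNeg : ∀ {i} → 0ℤ ℤ.< i → 0ℚ ℚ.≤ recip (fromℤ i)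
recip-nonNeg {i} 0<i = *≤1⇒≤recip 0<i
  (subst (ℚ._≤ 1ℚ) (sym (ℚ.*-zeroˡ (fromℤ i))) (ℚ.<⇒≤ (ℚ.positive⁻¹ 1ℚ)))

-- A positive `ε` has numerator at least 1, hence is at least the reciprocal of its own denominator.
-- This makes `↧ ε` an explicit threshold.
recip-< : ∀ {ε i} → 0ℚ ℚ.< ε → ↧ ε ℤ.< i → recip (fromℤ i) ℚ.< ε
recip-< {ε} {i} 0<ε ↧ε<i = ℚ.*-cancelʳ-<-nonNeg (fromℤ i)
  {{ℚ.pos⇒nonNeg (fromℤ i) {{fromℤ-positive 0<i}}}} (begin-strict
  recip (fromℤ i) ℚ.* fromℤ i ≡⟨ recip-fromℤ 0<i ⟩
  1ℚ                          ≤⟨ fromℤ-mono-≤ (ℤ.i<j⇒suc[i]≤j 0<↥ε) ⟩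
  fromℤ (↥ ε)                 ≡⟨ sym (*-↧ ε) ⟩
  ε ℚ.* fromℤ (↧ ε)           <⟨ ℚ.*-monoʳ-<-pos ε {{ℚ.positive 0<ε}} (fromℤ-mono-< ↧ε<i) ⟩
  ε ℚ.* fromℤ i               ∎)
  where
  open ℚ.≤-Reasoning
  0<i : 0ℤ ℤ.< i
  0<i = ℤ.<-trans (ℤ.+<+ (s≤s z≤n)) ↧ε<i
  0<↥ε : 0ℤ ℤ.< ↥ ε
  0<↥ε = subst₂ ℤ._<_ (ℤ.*-zeroˡ (↧ ε)) (ℤ.*-identityʳ (↥ ε)) (ℚ.drop-*<* 0<ε)

-- Numerators and denominators of convergents

P Q : (ℕ → ℤ) → ℕ → ℤ
P a zero          = a 0
P a (suc zero)    = a 1 ℤ.* a 0 ℤ.+ 1ℤ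
P a (suc (suc n)) = a (2 + n) ℤ.* P a (suc n) ℤ.+ P a n
Q a zero          = 1ℤ
Q a (suc zero)    = a 1
Q a (suc (suc n)) = a (2 + n) ℤ.* Q a (suc n) ℤ.+ Q a n

-- Together with `P-suc` this says that a₀ + q′/p′ is the whole fraction when p′/q′ is its tail,
-- which is the way `cf` recurses.
Q-suc : ∀ a n → Q a (suc n) ≡ P (a ∘ suc) n
Q-suc a zero          = refl
Q-suc a (suc zero)    = refl
Q-suc a (suc (suc n)) =
  cong₂ (λ s t → a (3 + n) ℤ.* s ℤ.+ t) (Q-suc a (suc n)) (Q-suc a n)

P-suc : ∀ a n → P a (suc n) ≡ a 0 ℤ.* P (a ∘ suc) n ℤ.+ Q (a ∘ suc) n
P-suc a zero = cong (ℤ._+ 1ℤ) (ℤ.*-comm (a 1) (a 0))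
P-suc a (suc zero) = identity (a 0) (a 1) (a 2)
  where
  identity : ∀ s t r → r ℤ.* (t ℤ.* s ℤ.+ 1ℤ) ℤ.+ s ≡ s ℤ.* (r ℤ.* t ℤ.+ 1ℤ) ℤ.+ r
  identity = solve-∀
P-suc a (suc (suc n)) = trans
  (cong₂ (λ s t → a (3 + n) ℤ.* s ℤ.+ t) (P-suc a (suc n)) (P-suc a n))
  (identity (a (3 + n)) (a 0) (P (a ∘ suc) (suc n)) (Q (a ∘ suc) (suc n))
            (P (a ∘ suc) n) (Q (a ∘ suc) n))
  where
  identity : ∀ s t p q p′ q′ → s ℤ.* (t ℤ.* p ℤ.+ q) ℤ.+ (t ℤ.* p′ ℤ.+ q′) ≡
                               t ℤ.* (s ℤ.* p ℤ.+ p′) ℤ.+ (s ℤ.* q ℤ.+ q′)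
  identity = solve-∀

P-Q-determinant : ∀ a n → P a (suc n) ℤ.* Q a n ℤ.- P a n ℤ.* Q a (suc n) ≡ -1ℤ ℤ.^ n
P-Q-determinant a zero = identity (a 0) (a 1)
  where
  identity : ∀ s t → (t ℤ.* s ℤ.+ 1ℤ) ℤ.* 1ℤ ℤ.- s ℤ.* t ≡ 1ℤ
  identity = solve-∀
P-Q-determinant a (suc n) = trans
  (identity (a (2 + n)) (P a (suc n)) (Q a (suc n)) (P a n) (Q a n))
  (cong (-1ℤ ℤ.*_) (P-Q-determinant a n))
  where
  identity : ∀ s p q p′ q′ → (s ℤ.* p ℤ.+ p′) ℤ.* q ℤ.- p ℤ.* (s ℤ.* q ℤ.+ q′) ≡
                             -1ℤ ℤ.* (p ℤ.* q′ ℤ.- p′ ℤ.* q)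
  identity = solve-∀

Q-cong : ∀ {a b} n → (∀ j → j ≤ n → a j ≡ b j) → Q a n ≡ Q b n
Q-cong zero          a≡b = refl
Q-cong (suc zero)    a≡b = a≡b 1 ℕ.≤-refl
Q-cong (suc (suc n)) a≡b = cong₂ ℤ._+_
  (cong₂ ℤ._*_ (a≡b (2 + n) ℕ.≤-refl) (Q-cong (suc n) (λ j j≤ → a≡b j (ℕ.m≤n⇒m≤1+n j≤))))
  (Q-cong n (λ j j≤ → a≡b j (ℕ.m≤n⇒m≤1+n (ℕ.m≤n⇒m≤1+n j≤))))

cf-cong : ∀ {a b} n → (∀ j → j ≤ n → a j ≡ b j) → cf a n ≡ cf b n
cf-cong zero    a≡b = cong fromℤ (a≡b 0 z≤n)
cf-cong (suc n) a≡b = cong₂ (λ s r → fromℤ s ℚ.+ recip r) (a≡b 0 z≤n)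
  (cf-cong n (λ j j≤n → a≡b (suc j) (s≤s j≤n)))

-- Zero partial quotients are admitted except at the end, as the
-- degenerate case of the theorem has one.
record Admissible (a : ℕ → ℤ) (n : ℕ) : Set where
  field
    inner : ∀ j → 1 ≤ j → j ≤ n → 0ℤ ℤ.≤ a j
    last  : 1 ≤ n → 0ℤ ℤ.< a n

open Admissible

admissible-tail : ∀ {a n} → Admissible a (suc n) → Admissible (a ∘ suc) n
admissible-tail adm .inner j _ j≤n = adm .inner (suc j) (s≤s z≤n) (s≤s j≤n)
admissible-tail adm .last _ = adm .last (s≤s z≤n)

0≤*0≤ : ∀ {i j} → 0ℤ ℤ.≤ i → 0ℤ ℤ.≤ j → 0ℤ ℤ.≤ i ℤ.* j
0≤*0≤ {i} {j} 0≤i 0≤j =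
  subst (ℤ._≤ i ℤ.* j) (ℤ.*-zeroˡ j) (ℤ.*-monoʳ-≤-nonNeg j {{ℤ.nonNegative 0≤j}} 0≤i)

-- The induction runs over tails, because a tail keeps the final entry, while an initial segment of
-- an admissible sequence may end in 0.
P-tail-positive : ∀ {a} n → Admissible a (suc n) → 0ℤ ℤ.< P (a ∘ suc) n
Q-positive : ∀ {a} n → Admissible a n → 0ℤ ℤ.< Q a n
P-tail-positive zero adm = adm .last (s≤s z≤n)
P-tail-positive {a} (suc n) adm = subst (0ℤ ℤ.<_) (sym (P-suc (a ∘ suc) n))
  (ℤ.+-mono-≤-< (0≤*0≤ (adm .inner 1 (s≤s z≤n) (s≤s z≤n))
                        (ℤ.<⇒≤ (P-tail-positive n (admissible-tail adm))))
                (Q-positive n (admissible-tail (admissible-tail adm))))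
Q-positive zero adm = ℤ.+<+ (s≤s z≤n)
Q-positive {a} (suc n) adm = subst (0ℤ ℤ.<_) (sym (Q-suc a n)) (P-tail-positive n adm)

cf-fraction : ∀ {a} n → Admissible a n → cf a n ℚ.* fromℤ (Q a n) ≡ fromℤ (P a n)
cf-fraction {a} zero adm = ℚ.*-identityʳ (fromℤ (a 0))
cf-fraction {a} (suc n) adm = begin
  (fromℤ (a 0) ℚ.+ recip r) ℚ.* fromℤ (Q a (suc n))
    ≡⟨ cong (λ i → (fromℤ (a 0) ℚ.+ recip r) ℚ.* fromℤ i) (Q-suc a n) ⟩
  (fromℤ (a 0) ℚ.+ recip r) ℚ.* fromℤ p
    ≡⟨ ℚ.*-distribʳ-+ (fromℤ p) (fromℤ (a 0)) (recip r) ⟩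
  fromℤ (a 0) ℚ.* fromℤ p ℚ.+ recip r ℚ.* fromℤ p
    ≡⟨ cong₂ ℚ._+_ (sym (fromℤ-* (a 0) p)) recip-step ⟩
  fromℤ (a 0 ℤ.* p) ℚ.+ fromℤ q
    ≡⟨ sym (fromℤ-+ (a 0 ℤ.* p) q) ⟩
  fromℤ (a 0 ℤ.* p ℤ.+ q)
    ≡⟨ cong fromℤ (sym (P-suc a n)) ⟩
  fromℤ (P a (suc n)) ∎
  where
  open ≡-Reasoning
  r = cf (a ∘ suc) n
  p = P (a ∘ suc) n
  q = Q (a ∘ suc) n
  r*q≡p : r ℚ.* fromℤ q ≡ fromℤ p
  r*q≡p = cf-fraction n (admissible-tail adm)
  -- The tail has a positive numerator, so `recip` is applied to a nonzero value here even if the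
  -- leading entry of the tail is 0.
  r≢0 : r ≢ 0ℚ
  r≢0 r≡0 = fromℤ≢0 (P-tail-positive n adm)
    (trans (sym r*q≡p) (trans (cong (ℚ._* fromℤ q) r≡0) (ℚ.*-zeroˡ (fromℤ q))))
  recip-step : recip r ℚ.* fromℤ p ≡ fromℤ q
  recip-step = begin
    recip r ℚ.* fromℤ p           ≡⟨ cong (recip r ℚ.*_) (sym r*q≡p) ⟩
    recip r ℚ.* (r ℚ.* fromℤ q)   ≡⟨ sym (ℚ.*-assoc (recip r) r (fromℤ q)) ⟩
    recip r ℚ.* r ℚ.* fromℤ q     ≡⟨ cong (ℚ._* fromℤ q) (recip-inverseˡ r r≢0) ⟩
    1ℚ ℚ.* fromℤ q                ≡⟨ ℚ.*-identityˡ (fromℤ q) ⟩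
    fromℤ q                       ∎

-- Lowest terms and distances between convergents

∣-1^n∣≡1 : ∀ n → ∣ -1ℤ ℤ.^ n ∣ ≡ 1
∣-1^n∣≡1 zero    = refl
∣-1^n∣≡1 (suc n) = trans (ℤ.abs-* -1ℤ (-1ℤ ℤ.^ n)) (trans (ℕ.*-identityˡ _) (∣-1^n∣≡1 n))

-- A common divisor divides the determinant, which is 1 or -1.
P-Q-coprime : ∀ a n → ℤ.Coprime (P a n) (Q a n)
P-Q-coprime a zero    = Coprimality.sym (1-coprimeTo ∣ P a 0 ∣)
P-Q-coprime a (suc n) {d} (d∣P , d∣Q) = ℕ.∣1⇒≡1 (subst (d ℕ.∣_) (∣-1^n∣≡1 n)
  (ℤˢ.∣⇒∣ᵤ {ℤ.+ d} (subst (ℤ.+ d ℤˢ.∣_) (P-Q-determinant a n)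
    (ℤˢ.∣m∣n⇒∣m-n (ℤˢ.∣m⇒∣m*n (Q a n) (ℤˢ.∣ᵤ⇒∣ {ℤ.+ d} {P a (suc n)} d∣P))
                  (ℤˢ.∣n⇒∣m*n (P a n) (ℤˢ.∣ᵤ⇒∣ {ℤ.+ d} {Q a (suc n)} d∣Q))))))

↥-↧-coprime : ∀ r → ℤ.Coprime (↥ r) (↧ r)
↥-↧-coprime (mkℚ _ _ c) = Coprimality.recompute c

-- Cross multiplication and coprimality on both sides make the two denominators divide each other;
-- positivity settles the sign.
↧-fraction : ∀ r p q → ℤ.Coprime p q → 0ℤ ℤ.< q → r ℚ.* fromℤ q ≡ fromℤ p → ↧ r ≡ q
↧-fraction r p q coprime 0<q eq = trans
  (cong ℤ.+_ (ℕ.∣-antisym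
    (ℤ.coprime-divisor (↧ r) (↥ r) q (Coprimality.sym (↥-↧-coprime r))
      (ℤˢ.∣⇒∣ᵤ (ℤˢ.divides p cross)))
    (ℤ.coprime-divisor q p (↧ r) (Coprimality.sym coprime)
      (ℤˢ.∣⇒∣ᵤ (ℤˢ.divides (↥ r) (sym cross))))))
  (ℤ.0≤i⇒+∣i∣≡i (ℤ.<⇒≤ 0<q))
  where
  cross = fraction-cross r {p} {q} eq

↧-cf : ∀ {a} n → Admissible a n → ↧ (cf a n) ≡ Q a n
↧-cf {a} n adm =
  ↧-fraction (cf a n) (P a n) (Q a n) (P-Q-coprime a n) (Q-positive n adm) (cf-fraction n adm)

*-cancelˡ-≡ : ∀ {r s t} → r ≢ 0ℚ → r ℚ.* s ≡ r ℚ.* t → s ≡ t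
*-cancelˡ-≡ {r} {s} {t} r≢0 eq = begin
  s                       ≡⟨ sym (cancel s) ⟩
  recip r ℚ.* (r ℚ.* s)   ≡⟨ cong (recip r ℚ.*_) eq ⟩
  recip r ℚ.* (r ℚ.* t)   ≡⟨ cancel t ⟩
  t                       ∎
  where
  open ≡-Reasoning
  cancel : ∀ v → recip r ℚ.* (r ℚ.* v) ≡ v
  cancel v = trans (sym (ℚ.*-assoc (recip r) r v))
    (trans (cong (ℚ._* v) (recip-inverseˡ r r≢0)) (ℚ.*-identityˡ v))

∣fromℤ∣ : ∀ i → ℚ.∣ fromℤ i ∣ ≡ fromℤ (ℤ.+ ∣ i ∣)
∣fromℤ∣ i = trans (cong ℚ.∣_∣ (fromℤ≡/1 i)) (trans (∣/1∣ i) (sym (fromℤ≡/1 (ℤ.+ ∣ i ∣))))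
  where
  ∣/1∣ : ∀ i → ℚ.∣ i /1 ∣ ≡ (ℤ.+ ∣ i ∣) /1
  ∣/1∣ (ℤ.+ _)  = refl
  ∣/1∣ -[1+ _ ] = refl

fraction-difference : ∀ r r′ p q p′ q′ →
  r ℚ.* fromℤ q ≡ fromℤ p → r′ ℚ.* fromℤ q′ ≡ fromℤ p′ →
  (r′ ℚ.- r) ℚ.* (fromℤ q ℚ.* fromℤ q′) ≡ fromℤ (p′ ℤ.* q ℤ.- p ℤ.* q′)
fraction-difference r r′ p q p′ q′ eq eq′ = begin
  (r′ ℚ.- r) ℚ.* (fromℤ q ℚ.* fromℤ q′)
    ≡⟨ identity r r′ (fromℤ q) (fromℤ q′) ⟩
  r′ ℚ.* fromℤ q′ ℚ.* fromℤ q ℚ.- r ℚ.* fromℤ q ℚ.* fromℤ q′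
    ≡⟨ cong₂ (λ s t → s ℚ.* fromℤ q ℚ.- t ℚ.* fromℤ q′) eq′ eq ⟩
  fromℤ p′ ℚ.* fromℤ q ℚ.- fromℤ p ℚ.* fromℤ q′
    ≡⟨ sym (cong₂ ℚ._-_ (fromℤ-* p′ q) (fromℤ-* p q′)) ⟩
  fromℤ (p′ ℤ.* q) ℚ.- fromℤ (p ℤ.* q′)
    ≡⟨ cong (fromℤ (p′ ℤ.* q) ℚ.+_) (sym (fromℤ-neg (p ℤ.* q′))) ⟩
  fromℤ (p′ ℤ.* q) ℚ.+ fromℤ (ℤ.- (p ℤ.* q′))
    ≡⟨ sym (fromℤ-+ (p′ ℤ.* q) (ℤ.- (p ℤ.* q′))) ⟩
  fromℤ (p′ ℤ.* q ℤ.- p ℤ.* q′) ∎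
  where
  open ≡-Reasoning
  open +-*-Solver
  identity : ∀ r r′ s s′ →
    (r′ ℚ.- r) ℚ.* (s ℚ.* s′) ≡ r′ ℚ.* s′ ℚ.* s ℚ.- r ℚ.* s ℚ.* s′
  identity = solve 4 (λ r r′ s s′ →
    (r′ :- r) :* (s :* s′) := r′ :* s′ :* s :- r :* s :* s′) refl

∣p*q∣≡∣p∣*q : ∀ p {q} → 0ℚ ℚ.≤ q → ℚ.∣ p ℚ.* q ∣ ≡ ℚ.∣ p ∣ ℚ.* q
∣p*q∣≡∣p∣*q p {q} 0≤q = trans (ℚ.∣p*q∣≡∣p∣*∣q∣ p q) (cong (ℚ.∣ p ∣ ℚ.*_) (ℚ.0≤p⇒∣p∣≡p 0≤q))

-- The distance is exactly 1/(q q′), and q′ is at least 1.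
unimodular-distance : ∀ r r′ p q p′ q′ →
  r ℚ.* fromℤ q ≡ fromℤ p → r′ ℚ.* fromℤ q′ ≡ fromℤ p′ →
  0ℤ ℤ.< q → 0ℤ ℤ.< q′ → ∣ p′ ℤ.* q ℤ.- p ℤ.* q′ ∣ ≡ 1 →
  ℚ.∣ r′ ℚ.- r ∣ ℚ.≤ recip (fromℤ q)
unimodular-distance r r′ p q p′ q′ eq eq′ 0<q 0<q′ unimodular = *≤1⇒≤recip 0<q (begin
  ℚ.∣ z ∣ ℚ.* fromℤ q
    ≡⟨ cong (ℚ.∣ z ∣ ℚ.*_) (sym (ℚ.*-identityʳ (fromℤ q))) ⟩
  ℚ.∣ z ∣ ℚ.* (fromℤ q ℚ.* 1ℚ)
    ≤⟨ ℚ.*-monoˡ-≤-nonNeg ℚ.∣ z ∣ {{ℚ.∣-∣-nonNeg z}}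
         (ℚ.*-monoˡ-≤-nonNeg (fromℤ q) {{ℚ.nonNegative 0≤fq}}
           (fromℤ-mono-≤ (ℤ.i<j⇒suc[i]≤j 0<q′))) ⟩
  ℚ.∣ z ∣ ℚ.* (fromℤ q ℚ.* fromℤ q′)
    ≡⟨ sym (∣p*q∣≡∣p∣*q z 0≤fqq′) ⟩
  ℚ.∣ z ℚ.* (fromℤ q ℚ.* fromℤ q′) ∣
    ≡⟨ cong ℚ.∣_∣ (fraction-difference r r′ p q p′ q′ eq eq′) ⟩
  ℚ.∣ fromℤ (p′ ℤ.* q ℤ.- p ℤ.* q′) ∣
    ≡⟨ trans (∣fromℤ∣ (p′ ℤ.* q ℤ.- p ℤ.* q′)) (cong (fromℤ ∘ ℤ.+_) unimodular) ⟩
  1ℚ ∎)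
  where
  open ℚ.≤-Reasoning
  z = r′ ℚ.- r
  0≤fq : 0ℚ ℚ.≤ fromℤ q
  0≤fq = fromℤ-mono-≤ (ℤ.<⇒≤ 0<q)
  0≤fqq′ : 0ℚ ℚ.≤ fromℤ q ℚ.* fromℤ q′
  0≤fqq′ = subst (0ℚ ℚ.≤_) (fromℤ-* q q′) (fromℤ-mono-≤ (0≤*0≤ (ℤ.<⇒≤ 0<q) (ℤ.<⇒≤ 0<q′)))

-- Limits

∣p-q∣≡∣q-p∣ : ∀ p q → ℚ.∣ p ℚ.- q ∣ ≡ ℚ.∣ q ℚ.- p ∣
∣p-q∣≡∣q-p∣ p q = trans (cong ℚ.∣_∣ (identity p q)) (ℚ.∣-p∣≡∣p∣ (q ℚ.- p))
  where
  open +-*-Solver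
  identity : ∀ p q → p ℚ.- q ≡ ℚ.- (q ℚ.- p)
  identity = solve 2 (λ p q → p :- q := :- (q :- p)) refl

∣p-r∣≤∣p-q∣+∣q-r∣ : ∀ p q r → ℚ.∣ p ℚ.- r ∣ ℚ.≤ ℚ.∣ p ℚ.- q ∣ ℚ.+ ℚ.∣ q ℚ.- r ∣
∣p-r∣≤∣p-q∣+∣q-r∣ p q r = subst (λ t → ℚ.∣ t ∣ ℚ.≤ ℚ.∣ p ℚ.- q ∣ ℚ.+ ℚ.∣ q ℚ.- r ∣)
  (identity p q r) (ℚ.∣p+q∣≤∣p∣+∣q∣ (p ℚ.- q) (q ℚ.- r))
  where
  open +-*-Solver
  identity : ∀ p q r → p ℚ.- q ℚ.+ (q ℚ.- r) ≡ p ℚ.- r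
  identity = solve 3 (λ p q r → p :- q :+ (q :- r) := p :- r) refl

Vanishing : (ℕ → ℚ) → Set
Vanishing h = ∀ ε → 0ℚ ℚ.< ε → ∃[ N ] (∀ n → N ≤ n → h n ℚ.< ε)

module _ {S h : ℕ → ℚ}
  (0≤h     : ∀ n → 0ℚ ℚ.≤ h n)
  (steps   : ∀ n → ℚ.∣ S (suc n) ℚ.- S n ∣ ℚ.≤ h (suc n))
  (halving : ∀ n → h (suc n) ℚ.+ h (suc n) ℚ.≤ h n)
  (vanish  : Vanishing h) where

  private
    -- The extra summand `h (d + n)` is what makes the induction close: by halving, `h e` pays for
    -- the step `h (suc e)` and still leaves `h (suc e)` over.
    distance : ∀ n d → ℚ.∣ S (d + n) ℚ.- S n ∣ ℚ.+ h (d + n) ℚ.≤ h n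
    distance n zero    = ℚ.≤-reflexive (trans
      (cong (λ t → ℚ.∣ t ∣ ℚ.+ h n) (ℚ.+-inverseʳ (S n))) (ℚ.+-identityˡ (h n)))
    distance n (suc d) = begin
      ℚ.∣ S (suc e) ℚ.- S n ∣ ℚ.+ h (suc e)
        ≤⟨ ℚ.+-monoˡ-≤ (h (suc e)) (∣p-r∣≤∣p-q∣+∣q-r∣ (S (suc e)) (S e) (S n)) ⟩
      ℚ.∣ S (suc e) ℚ.- S e ∣ ℚ.+ ℚ.∣ S e ℚ.- S n ∣ ℚ.+ h (suc e)
        ≤⟨ ℚ.+-monoˡ-≤ (h (suc e)) (ℚ.+-monoˡ-≤ ℚ.∣ S e ℚ.- S n ∣ (steps e)) ⟩
      h (suc e) ℚ.+ ℚ.∣ S e ℚ.- S n ∣ ℚ.+ h (suc e)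
        ≡⟨ identity (h (suc e)) ℚ.∣ S e ℚ.- S n ∣ ⟩
      ℚ.∣ S e ℚ.- S n ∣ ℚ.+ (h (suc e) ℚ.+ h (suc e))
        ≤⟨ ℚ.+-monoʳ-≤ ℚ.∣ S e ℚ.- S n ∣ (halving e) ⟩
      ℚ.∣ S e ℚ.- S n ∣ ℚ.+ h e
        ≤⟨ distance n d ⟩
      h n ∎
      where
      open ℚ.≤-Reasoning
      e = d + n
      open +-*-Solver
      identity : ∀ s t → s ℚ.+ t ℚ.+ s ≡ t ℚ.+ (s ℚ.+ s)
      identity = solve 2 (λ s t → s :+ t :+ s := t :+ (s :+ s)) refl

    distance-≤ : ∀ {n i} → n ≤ i → ℚ.∣ S i ℚ.- S n ∣ ℚ.≤ h n
    distance-≤ {n} {i} n≤i = subst (λ i → ℚ.∣ S i ℚ.- S n ∣ ℚ.≤ h n) (ℕ.m∸n+n≡m n≤i) (begin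
      ℚ.∣ S (d + n) ℚ.- S n ∣                 ≡⟨ sym (ℚ.+-identityʳ _) ⟩
      ℚ.∣ S (d + n) ℚ.- S n ∣ ℚ.+ 0ℚ          ≤⟨ ℚ.+-monoʳ-≤ ℚ.∣ S (d + n) ℚ.- S n ∣ (0≤h (d + n)) ⟩
      ℚ.∣ S (d + n) ℚ.- S n ∣ ℚ.+ h (d + n)   ≤⟨ distance n d ⟩
      h n                                     ∎)
      where
      open ℚ.≤-Reasoning
      d = i ∸ n

    isCauchy : ∀ ε → 0ℚ ℚ.< ε →
      ∃[ N ] (∀ i j → N ≤ i → N ≤ j → ℚ.∣ S i ℚ.- S j ∣ ℚ.< ε)
    isCauchy ε 0<ε with vanish ε 0<ε
    -- Both indices are compared with `suc N` rather than `N`, since halving absorbs the two errors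
    -- `h (suc N)` into a single `h N`.
    ... | N , h<ε = suc N , λ i j N<i N<j → begin-strict
      ℚ.∣ S i ℚ.- S j ∣
        ≤⟨ ∣p-r∣≤∣p-q∣+∣q-r∣ (S i) (S (suc N)) (S j) ⟩
      ℚ.∣ S i ℚ.- S (suc N) ∣ ℚ.+ ℚ.∣ S (suc N) ℚ.- S j ∣
        ≡⟨ cong (ℚ.∣ S i ℚ.- S (suc N) ∣ ℚ.+_) (∣p-q∣≡∣q-p∣ (S (suc N)) (S j)) ⟩
      ℚ.∣ S i ℚ.- S (suc N) ∣ ℚ.+ ℚ.∣ S j ℚ.- S (suc N) ∣
        ≤⟨ ℚ.+-mono-≤ (distance-≤ N<i) (distance-≤ N<j) ⟩
      h (suc N) ℚ.+ h (suc N)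
        ≤⟨ halving N ⟩
      h N
        <⟨ h<ε N ℕ.≤-refl ⟩
      ε ∎
      where open ℚ.≤-Reasoning

    limit : ℝ
    limit = record { approx = S ; cauchy = isCauchy }

  convergent : ∃[ α ] (S ⟶ α)
  convergent = limit , λ ε 0<ε → proj₁ (isCauchy ε 0<ε) , λ n N≤n δ 0<δ →
    proj₁ (isCauchy ε 0<ε) , λ i N≤i →
    ℚ.<-trans (proj₂ (isCauchy ε 0<ε) n i N≤n N≤i)
      (subst (ℚ._< ε ℚ.+ δ) (ℚ.+-identityʳ ε) (ℚ.+-monoʳ-< ε 0<δ))

-- Half of `ε` pays for `h`, the other half for the limit of `S`. The index `s` may depend on `n`,
-- because three consecutive convergents will share one partial sum.
⟶-close : ∀ {S h r : ℕ → ℚ} {α} → Vanishing h →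
  (∀ N → ∃[ M ] (∀ n → M ≤ n → ∃[ s ] (N ≤ s × ℚ.∣ r n ℚ.- S s ∣ ℚ.≤ h s))) →
  S ⟶ α → r ⟶ α
⟶-close {S} {h} {r} {α} vanish close S⟶α ε 0<ε = M , within
  where
  ε/2 = ℚ.½ ℚ.* ε
  0<ε/2 : 0ℚ ℚ.< ε/2
  0<ε/2 = subst (ℚ._< ε/2) (ℚ.*-zeroʳ ℚ.½) (ℚ.*-monoʳ-<-pos ℚ.½ 0<ε)
  ε/2+ε/2 : ε/2 ℚ.+ ε/2 ≡ ε
  ε/2+ε/2 = trans (sym (ℚ.*-distribʳ-+ ε ℚ.½ ℚ.½)) (ℚ.*-identityˡ ε)
  N₁ = proj₁ (vanish ε/2 0<ε/2)
  N₂ = proj₁ (S⟶α ε/2 0<ε/2)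
  M  = proj₁ (close (N₁ + N₂))
  within : ∀ n → M ≤ n → Within (r n) α ε
  within n M≤n δ 0<δ with proj₂ (close (N₁ + N₂)) n M≤n
  ... | s , N≤s , r≈S
    with proj₂ (S⟶α ε/2 0<ε/2) s (ℕ.≤-trans (ℕ.m≤n+m N₂ N₁) N≤s) δ 0<δ
  ... | L , S≈α = L , λ i L≤i → begin-strict
    ℚ.∣ r n ℚ.- approx α i ∣
      ≤⟨ ∣p-r∣≤∣p-q∣+∣q-r∣ (r n) (S s) (approx α i) ⟩
    ℚ.∣ r n ℚ.- S s ∣ ℚ.+ ℚ.∣ S s ℚ.- approx α i ∣
      <⟨ ℚ.+-mono-≤-< r≈S (S≈α i L≤i) ⟩
    h s ℚ.+ (ε/2 ℚ.+ δ)
      <⟨ ℚ.+-monoˡ-< (ε/2 ℚ.+ δ) (proj₂ (vanish ε/2 0<ε/2) s (ℕ.≤-trans (ℕ.m≤m+n N₁ N₂) N≤s)) ⟩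
    ε/2 ℚ.+ (ε/2 ℚ.+ δ)
      ≡⟨ trans (sym (ℚ.+-assoc ε/2 ε/2 δ)) (cong (ℚ._+ δ) ε/2+ε/2) ⟩
    ε ℚ.+ δ ∎
    where open ℚ.≤-Reasoning

-- The expansion of α

i≤j*i : ∀ {i j} → 0ℤ ℤ.< j → 0ℤ ℤ.≤ i → i ℤ.≤ j ℤ.* i
i≤j*i {i} {j} 0<j 0≤i = subst (ℤ._≤ j ℤ.* i) (ℤ.*-identityˡ i)
  (ℤ.*-monoʳ-≤-nonNeg i {{ℤ.nonNegative 0≤i}} (ℤ.i<j⇒suc[i]≤j 0<j))

1<i⇒0<i-1 : ∀ {i} → 1ℤ ℤ.< i → 0ℤ ℤ.< i ℤ.- 1ℤ
1<i⇒0<i-1 = ℤ.+-monoˡ-< -1ℤ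

1<i+j : ∀ {i j} → 0ℤ ℤ.< i → 0ℤ ℤ.< j → 1ℤ ℤ.< i ℤ.+ j
1<i+j 0<i 0<j = ℤ.+-mono-≤-< (ℤ.i<j⇒suc[i]≤j 0<i) 0<j

-- As u y ≥ 1 in any case, it is enough that one of m > 0, u > 1, y > 1 holds. The remaining case is
-- the source of `Degenerate`.
m+uy-1-positive : ∀ {m u y} → 0ℤ ℤ.≤ m → 0ℤ ℤ.< u → 0ℤ ℤ.< y →
  0ℤ ℤ.< m ℤ.+ u ℤ.* y ℤ.- 1ℤ ⊎ (m ≡ 0ℤ × u ≡ 1ℤ × y ≡ 1ℤ)
m+uy-1-positive {m} {u} {y} 0≤m 0<u 0<y with 0ℤ ℤ.<? m | 1ℤ ℤ.<? u | 1ℤ ℤ.<? y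
... | yes 0<m | _       | _       = inj₁ (1<i⇒0<i-1 (1<i+j 0<m
  (ℤ.<-≤-trans 0<y (i≤j*i 0<u (ℤ.<⇒≤ 0<y)))))
... | no  _   | yes 1<u | _       = inj₁ (1<i⇒0<i-1 (ℤ.+-mono-≤-< 0≤m
  (ℤ.<-≤-trans 1<u (subst (u ℤ.≤_) (ℤ.*-comm y u) (i≤j*i 0<y (ℤ.<⇒≤ 0<u))))))
... | no  _   | no _    | yes 1<y = inj₁ (1<i⇒0<i-1 (ℤ.+-mono-≤-< 0≤m
  (ℤ.<-≤-trans 1<y (i≤j*i 0<u (ℤ.<⇒≤ 0<y)))))
... | no  m≤0 | no u≤1  | no y≤1  = inj₂
  ( sym (ℤ.≤∧≮⇒≡ 0≤m m≤0)
  , sym (ℤ.≤∧≮⇒≡ (ℤ.i<j⇒suc[i]≤j 0<u) u≤1)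
  , sym (ℤ.≤∧≮⇒≡ (ℤ.i<j⇒suc[i]≤j 0<y) y≤1))

-- Assembling the partial quotients

splice : ℕ → (ℕ → ℤ) → (ℕ → ℤ) → ℕ → ℤ
splice zero    c b j       = b j
splice (suc n) c b zero    = c 0
splice (suc n) c b (suc j) = splice n (c ∘ suc) b j

splice-< : ∀ {n c b j} → j < n → splice n c b j ≡ c j
splice-< {j = zero}  (s≤s _)   = refl
splice-< {j = suc j} (s≤s j<n) = splice-< j<n

splice-+ : ∀ n c b i → splice n c b (i + n) ≡ b i
splice-+ zero    c b i = cong b (ℕ.+-identityʳ i)
splice-+ (suc n) c b i =
  trans (cong (splice (suc n) c b) (ℕ.+-suc i n)) (splice-+ n (c ∘ suc) b i)

-- Unlike `3 * suc n`, `thrice (suc n)` reduces to `3 + thrice n`, so that `P`, `Q` and `extension`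
-- unfold by a whole period definitionally.
thrice : ℕ → ℕ
thrice zero    = 0
thrice (suc n) = 3 + thrice n

thrice≡3* : ∀ n → thrice n ≡ 3 * n
thrice≡3* zero    = refl
thrice≡3* (suc n) = trans (cong (3 +_) (thrice≡3* n)) (sym (ℕ.*-suc 3 n))

-- The partial quotients from index 2k + 2 on; m enters only the first of them.
extension : ℤ → (u x y : ℕ → ℤ) → ℕ → ℤ
extension m u x y zero                = m ℤ.+ u 1 ℤ.* y 0 ℤ.- 1ℤ
extension m u x y (suc zero)          = 1ℤ
extension m u x y (suc (suc zero))    = x 1 ℤ.- 1ℤ
extension m u x y (suc (suc (suc i))) = extension 0ℤ (u ∘ suc) (x ∘ suc) (y ∘ suc) i

extension-1 : ∀ m u x y n → extension m u x y (1 + thrice n) ≡ 1ℤ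
extension-1 m u x y zero    = refl
extension-1 m u x y (suc n) = extension-1 0ℤ (u ∘ suc) (x ∘ suc) (y ∘ suc) n

extension-2 : ∀ m u x y n → extension m u x y (2 + thrice n) ≡ x (suc n) ℤ.- 1ℤ
extension-2 m u x y zero    = refl
extension-2 m u x y (suc n) = extension-2 0ℤ (u ∘ suc) (x ∘ suc) (y ∘ suc) n

extension-3 : ∀ m u x y n →
  extension m u x y (3 + thrice n) ≡ u (2 + n) ℤ.* y (suc n) ℤ.- 1ℤ
extension-3 m u x y zero    = cong (ℤ._- 1ℤ) (ℤ.+-identityˡ (u 2 ℤ.* y 1))
extension-3 m u x y (suc n) = extension-3 0ℤ (u ∘ suc) (x ∘ suc) (y ∘ suc) n

-- Entry 0 is left out, because the degenerate value 0 can occur there.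
extension-positive : ∀ m u x y → (∀ n → 1ℤ ℤ.< x (suc n)) →
  (∀ n → 1ℤ ℤ.< u (2 + n) ℤ.* y (suc n)) →
  ∀ i → 0ℤ ℤ.< extension m u x y (suc i)
extension-positive m u x y 1<x 1<uy zero             = ℤ.+<+ (s≤s z≤n)
extension-positive m u x y 1<x 1<uy (suc zero)       = 1<i⇒0<i-1 (1<x 0)
extension-positive m u x y 1<x 1<uy (suc (suc zero)) =
  subst (0ℤ ℤ.<_) (sym (extension-3 m u x y 0)) (1<i⇒0<i-1 (1<uy 0))
extension-positive m u x y 1<x 1<uy (suc (suc (suc i))) =
  extension-positive 0ℤ (u ∘ suc) (x ∘ suc) (y ∘ suc) (1<x ∘ suc) (1<uy ∘ suc) i

-- Two convergents two apart are as close as neighbours when the entry `a (2 + n)` is 1, as happens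
-- once in each period.
P-Q-determinant₂ : ∀ a n →
  P a (2 + n) ℤ.* Q a n ℤ.- P a n ℤ.* Q a (2 + n) ≡ a (2 + n) ℤ.* -1ℤ ℤ.^ n
P-Q-determinant₂ a n = trans
  (identity (a (2 + n)) (P a (suc n)) (Q a (suc n)) (P a n) (Q a n))
  (cong (a (2 + n) ℤ.*_) (P-Q-determinant a n))
  where
  identity : ∀ s p q p′ q′ →
    (s ℤ.* p ℤ.+ p′) ℤ.* q′ ℤ.- p′ ℤ.* (s ℤ.* q ℤ.+ q′) ≡ s ℤ.* (p ℤ.* q′ ℤ.- p′ ℤ.* q)
  identity = solve-∀

P-Q-determinant₃ : ∀ a n →
  P a (3 + n) ℤ.* Q a n ℤ.- P a n ℤ.* Q a (3 + n) ≡
  (a (3 + n) ℤ.* a (2 + n) ℤ.+ 1ℤ) ℤ.* -1ℤ ℤ.^ n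
P-Q-determinant₃ a n = trans
  (identity (a (3 + n)) (a (2 + n)) (P a (suc n)) (Q a (suc n)) (P a n) (Q a n))
  (cong ((a (3 + n) ℤ.* a (2 + n) ℤ.+ 1ℤ) ℤ.*_) (P-Q-determinant a n))
  where
  identity : ∀ t s p q p′ q′ →
    (t ℤ.* (s ℤ.* p ℤ.+ p′) ℤ.+ p) ℤ.* q′ ℤ.- p′ ℤ.* (t ℤ.* (s ℤ.* q ℤ.+ q′) ℤ.+ q) ≡
    (t ℤ.* s ℤ.+ 1ℤ) ℤ.* (p ℤ.* q′ ℤ.- p′ ℤ.* q)
  identity = solve-∀

-- Here the restriction on m enters: the sum m x + q must exceed 1, which q ensures unless it is 1,
-- and then m x ≥ 1 does.
y₀-positive : ∀ {m x q} → 0ℤ ℤ.≤ m → 0ℤ ℤ.< x → 0ℤ ℤ.< q →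
  (q ≡ 1ℤ → 1ℤ ℤ.≤ m) → 0ℤ ℤ.< m ℤ.* x ℤ.+ q ℤ.- 1ℤ
y₀-positive {m} {x} {q} 0≤m 0<x 0<q q≡1⇒1≤m with q ℤ.≟ 1ℤ
... | yes q≡1 = 1<i⇒0<i-1 (1<i+j (ℤ.<-≤-trans 0<x
  (i≤j*i (ℤ.suc[i]≤j⇒i<j (q≡1⇒1≤m q≡1)) (ℤ.<⇒≤ 0<x))) 0<q)
... | no  q≢1 = 1<i⇒0<i-1 (ℤ.+-mono-≤-< (0≤*0≤ 0≤m (ℤ.<⇒≤ 0<x))
  (ℤ.≤∧≢⇒< (ℤ.i<j⇒suc[i]≤j 0<q) (q≢1 ∘ sym)))

module Expansion
  (p/q : ℚ) (m q₂ₖ : ℤ) (u : ℕ → ℤ) (k : ℕ) (c x y : ℕ → ℤ)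
  (0≤m : 0ℤ ℤ.≤ m)
  (0<u : ∀ n → 1 ≤ n → 0ℤ ℤ.< u n)
  (0<c : ∀ j → 1 ≤ j → j ≤ suc (2 * k) → 0ℤ ℤ.< c j)
  (p/q≡ : p/q ≡ cf c (suc (2 * k)))
  (q₂ₖ≡ : q₂ₖ ≡ Q c (2 * k))
  (0<q₂ₖ : 0ℤ ℤ.< q₂ₖ)
  (q≡1⇒1≤m : q₂ₖ ≡ 1ℤ → 1ℤ ℤ.≤ m)
  (1<x₁ : 1ℤ ℤ.< x 1)
  (x₁≡ : x 1 ≡ Q c (suc (2 * k)))
  (y₀≡ : y 0 ≡ m ℤ.* x 1 ℤ.+ q₂ₖ ℤ.- 1ℤ)
  (y≡ : ∀ j → 1 ≤ j → y j ≡ y (j ∸ 1) ℤ.* (1ℤ ℤ.+ u j ℤ.* x j))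
  (x≡ : ∀ j → 1 ≤ j → x (suc j) ≡ x j ℤ.* y j)
  where

  -- Growth of `x` and `y`

  y-suc : ∀ n → y (suc n) ≡ y n ℤ.* (1ℤ ℤ.+ u (suc n) ℤ.* x (suc n))
  y-suc n = y≡ (suc n) (s≤s z≤n)

  x-suc : ∀ n → x (2 + n) ≡ x (suc n) ℤ.* y (suc n)
  x-suc n = x≡ (suc n) (s≤s z≤n)

  private
    0<y₀ : 0ℤ ℤ.< y 0
    0<y₀ = subst (0ℤ ℤ.<_) (sym y₀≡) (y₀-positive 0≤m (ℤ.<-trans (ℤ.+<+ (s≤s z≤n)) 1<x₁)
      0<q₂ₖ q≡1⇒1≤m)

    1<y-step : ∀ {u x y y′} → 0ℤ ℤ.< u → 0ℤ ℤ.< x → 0ℤ ℤ.< y →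
      y′ ≡ y ℤ.* (1ℤ ℤ.+ u ℤ.* x) → 1ℤ ℤ.< y′
    1<y-step {u} {x} 0<u 0<x 0<y refl =
      ℤ.<-≤-trans 1<1+ux (i≤j*i 0<y (ℤ.<⇒≤ (ℤ.<-trans (ℤ.+<+ (s≤s z≤n)) 1<1+ux)))
      where
      1<1+ux : 1ℤ ℤ.< 1ℤ ℤ.+ u ℤ.* x
      1<1+ux = 1<i+j {1ℤ} (ℤ.+<+ (s≤s z≤n)) (ℤ.<-≤-trans 0<x (i≤j*i 0<u (ℤ.<⇒≤ 0<x)))

  x+x≤xy : ∀ {x y} → 0ℤ ℤ.≤ x → 1ℤ ℤ.< y → x ℤ.+ x ℤ.≤ x ℤ.* y
  x+x≤xy {x} {y} 0≤x 1<y = subst (ℤ._≤ x ℤ.* y) (identity x)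
    (ℤ.*-monoˡ-≤-nonNeg x {{ℤ.nonNegative 0≤x}} (ℤ.i<j⇒suc[i]≤j 1<y))
    where
    identity : ∀ x → x ℤ.* (ℤ.+ 2) ≡ x ℤ.+ x
    identity = solve-∀

  -- A single induction, since each part feeds the others: positive `x` and `y` make the next `y`
  -- exceed 1, so `x` at least doubles, and 1 + n < x + x. For `y` only positivity is claimed, as
  -- `y 0` may be 1. The last component makes the reciprocals of `x` tend to 0.
  bounds : ∀ n → 0ℤ ℤ.< y n × 1ℤ ℤ.< x (suc n) × ℤ.+ n ℤ.< x (suc n)
  bounds zero = 0<y₀ , 1<x₁ , ℤ.<-trans (ℤ.+<+ (s≤s z≤n)) 1<x₁
  bounds (suc n) with bounds n
  ... | 0<y , 1<x , n<x = 0<y′ , 1<x′ ,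
    ℤ.<-≤-trans (ℤ.+-mono-<  1<x n<x) x+x≤x′
    where
    0<x = ℤ.<-trans (ℤ.+<+ (s≤s z≤n)) 1<x
    1<y′ = 1<y-step (0<u (suc n) (s≤s z≤n)) 0<x 0<y (y-suc n)
    0<y′ = ℤ.<-trans (ℤ.+<+ (s≤s z≤n)) 1<y′
    x+x≤x′ : x (suc n) ℤ.+ x (suc n) ℤ.≤ x (2 + n)
    x+x≤x′ = subst (_ ℤ.≤_) (sym (x-suc n)) (x+x≤xy (ℤ.<⇒≤ 0<x) 1<y′)
    1<x′ : 1ℤ ℤ.< x (2 + n)
    1<x′ = ℤ.<-≤-trans (1<i+j 0<x 0<x) x+x≤x′

  1<x : ∀ n → 1ℤ ℤ.< x (suc n)
  1<x n = proj₁ (proj₂ (bounds n))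

  0<x : ∀ n → 0ℤ ℤ.< x (suc n)
  0<x n = ℤ.<-trans (ℤ.+<+ (s≤s z≤n)) (1<x n)

  n<x : ∀ n → ℤ.+ n ℤ.< x (suc n)
  n<x n = proj₂ (proj₂ (bounds n))

  1<y : ∀ n → 1ℤ ℤ.< y (suc n)
  1<y n = 1<y-step (0<u (suc n) (s≤s z≤n)) (0<x n) (proj₁ (bounds n)) (y-suc n)

  1<uy : ∀ n → 1ℤ ℤ.< u (2 + n) ℤ.* y (suc n)
  1<uy n = ℤ.<-≤-trans (1<y n) (i≤j*i (0<u (2 + n) (s≤s z≤n)) (ℤ.<⇒≤ (proj₁ (bounds (suc n)))))

  -- The sequence of partial quotients and its signs

  K : ℕ
  K = suc (2 * k)

  a : ℕ → ℤ
  a = splice (suc K) c (extension m u x y)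

  a-prefix : ∀ j → j ≤ K → a j ≡ c j
  a-prefix j j≤K = splice-< (s≤s j≤K)

  a-extension : ∀ i → a (suc (i + K)) ≡ extension m u x y i
  a-extension i = trans (cong a (sym (ℕ.+-suc i K))) (splice-+ (suc K) c (extension m u x y) i)

  a-1 : ∀ n → a (2 + (thrice n + K)) ≡ 1ℤ
  a-1 n = trans (a-extension (1 + thrice n)) (extension-1 m u x y n)

  a-2 : ∀ n → a (3 + (thrice n + K)) ≡ x (suc n) ℤ.- 1ℤ
  a-2 n = trans (a-extension (2 + thrice n)) (extension-2 m u x y n)

  a-3 : ∀ n → a (4 + (thrice n + K)) ≡ u (2 + n) ℤ.* y (suc n) ℤ.- 1ℤ
  a-3 n = trans (a-extension (3 + thrice n)) (extension-3 m u x y n)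

  a-first : a (suc K) ≡ m ℤ.+ u 1 ℤ.* y 0 ℤ.- 1ℤ
  a-first = a-extension 0

  -- Only index K + 1 can carry a zero. There m = 0 and y₀ = 1, and the definition of y₀ then forces
  -- q₂ₖ = 2.
  a-sign : ∀ j → 1 ≤ j → 0ℤ ℤ.< a j ⊎ (a j ≡ 0ℤ × Degenerate k m (u 1) q₂ₖ j)
  a-sign j 1≤j with j ℕ.≤? K
  ... | yes j≤K = inj₁ (subst (0ℤ ℤ.<_) (sym (a-prefix j j≤K)) (0<c j 1≤j j≤K))
  ... | no  j≰K = subst Sign (ℕ.m∸n+n≡m (ℕ.≰⇒> j≰K)) (later (j ∸ suc K))
    where
    Sign : ℕ → Set
    Sign j = 0ℤ ℤ.< a j ⊎ (a j ≡ 0ℤ × Degenerate k m (u 1) q₂ₖ j)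
    q≡2 : m ≡ 0ℤ → y 0 ≡ 1ℤ → q₂ₖ ≡ ℤ.+ 2
    q≡2 refl y₀≡1 = trans (identity q₂ₖ (x 1)) (cong ℤ.suc (trans (sym y₀≡) y₀≡1))
      where
      identity : ∀ q x → q ≡ 1ℤ ℤ.+ (0ℤ ℤ.* x ℤ.+ q ℤ.- 1ℤ)
      identity = solve-∀
    later : ∀ i → Sign (i + suc K)
    later (suc i) = inj₁ (subst (0ℤ ℤ.<_) (sym (splice-+ (suc K) c (extension m u x y) (suc i)))
      (extension-positive m u x y 1<x 1<uy i))
    later zero with m+uy-1-positive 0≤m (0<u 1 (s≤s z≤n)) (proj₁ (bounds 0))
    ... | inj₁ positive = inj₁ (subst (0ℤ ℤ.<_) (sym a-first) positive)
    ... | inj₂ (m≡0 , u≡1 , y≡1) = inj₂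
      ( trans a-first (cong (ℤ._- 1ℤ) (cong₂ ℤ._+_ m≡0 (cong₂ ℤ._*_ u≡1 y≡1)))
      , degenerate (ℕ.+-comm 2 (2 * k)) m≡0 u≡1 (q≡2 m≡0 y≡1))

  a-nonNeg : ∀ j → 1 ≤ j → 0ℤ ℤ.≤ a j
  a-nonNeg j 1≤j with a-sign j 1≤j
  ... | inj₁ 0<a       = ℤ.<⇒≤ 0<a
  ... | inj₂ (a≡0 , _) = ℤ.≤-reflexive (sym a≡0)

  a-positive : ∀ j → 1 ≤ j → ¬ Degenerate k m (u 1) q₂ₖ j → 0ℤ ℤ.< a j
  a-positive j 1≤j nondeg with a-sign j 1≤j
  ... | inj₁ 0<a       = 0<a
  ... | inj₂ (_ , deg) = contradiction deg nondeg

  admissible : ∀ n → ¬ Degenerate k m (u 1) q₂ₖ n → Admissible a n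
  admissible n nondeg .inner j 1≤j _ = a-nonNeg j 1≤j
  admissible n nondeg .last 1≤n = a-positive n 1≤n nondeg

  -- The exceptional index 2k + 2 is 1 + K.
  nondegenerate : ∀ i → i ≢ 1 → ¬ Degenerate k m (u 1) q₂ₖ (i + K)
  nondegenerate i i≢1 deg = i≢1 (ℕ.+-cancelʳ-≡ K i 1
    (trans (Degenerate.index deg) (ℕ.+-comm (2 * k) 2)))

  nondegenerate₀ : ∀ n → ¬ Degenerate k m (u 1) q₂ₖ (thrice n + K)
  nondegenerate₀ zero    = nondegenerate 0 λ ()
  nondegenerate₀ (suc n) = nondegenerate (3 + thrice n) λ ()

  nondegenerate₂ : ∀ n → ¬ Degenerate k m (u 1) q₂ₖ (2 + (thrice n + K))
  nondegenerate₂ n = nondegenerate (2 + thrice n) λ ()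

  -- Denominators of the convergents

  Q-first : ∀ n → Q a (thrice n + K) ≡ x (suc n) ×
                  Q a (1 + (thrice n + K)) ≡ y (suc n) ℤ.- x (suc n) ℤ.+ 1ℤ
  Q₂ : ∀ n → Q a (2 + (thrice n + K)) ≡ y (suc n) ℤ.+ 1ℤ

  Q₀ : ∀ n → Q a (thrice n + K) ≡ x (suc n)
  Q₀ n = proj₁ (Q-first n)

  Q₁ : ∀ n → Q a (1 + (thrice n + K)) ≡ y (suc n) ℤ.- x (suc n) ℤ.+ 1ℤ
  Q₁ n = proj₂ (Q-first n)

  -- The initial value y₀ is made for this case: m x₁ + q₂ₖ = y₀ + 1, so the new denominator is y₀ +
  -- 1 + u₁ y₀ x₁ - x₁.
  Q-first zero = Q-K , (begin
    a (suc K) ℤ.* Q a K ℤ.+ Q a (2 * k)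
      ≡⟨ cong₂ ℤ._+_ (cong₂ ℤ._*_ a-first Q-K) Q-2k ⟩
    (m ℤ.+ u 1 ℤ.* y 0 ℤ.- 1ℤ) ℤ.* x 1 ℤ.+ q₂ₖ
      ≡⟨ cong (λ t → (m ℤ.+ u 1 ℤ.* t ℤ.- 1ℤ) ℤ.* x 1 ℤ.+ q₂ₖ) y₀≡ ⟩
    _ ≡⟨ identity m (u 1) (x 1) q₂ₖ ⟩
    (m ℤ.* x 1 ℤ.+ q₂ₖ ℤ.- 1ℤ) ℤ.* (1ℤ ℤ.+ u 1 ℤ.* x 1) ℤ.- x 1 ℤ.+ 1ℤ
      ≡⟨ cong (λ t → t ℤ.* (1ℤ ℤ.+ u 1 ℤ.* x 1) ℤ.- x 1 ℤ.+ 1ℤ) (sym y₀≡) ⟩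
    y 0 ℤ.* (1ℤ ℤ.+ u 1 ℤ.* x 1) ℤ.- x 1 ℤ.+ 1ℤ
      ≡⟨ cong (λ t → t ℤ.- x 1 ℤ.+ 1ℤ) (sym (y-suc 0)) ⟩
    y 1 ℤ.- x 1 ℤ.+ 1ℤ ∎)
    where
    open ≡-Reasoning
    Q-K : Q a K ≡ x 1
    Q-K = trans (Q-cong K a-prefix) (sym x₁≡)
    Q-2k : Q a (2 * k) ≡ q₂ₖ
    Q-2k = trans (Q-cong (2 * k) (λ j j≤ → a-prefix j (ℕ.m≤n⇒m≤1+n j≤))) (sym q₂ₖ≡)
    identity : ∀ m u x q →
      (m ℤ.+ u ℤ.* (m ℤ.* x ℤ.+ q ℤ.- 1ℤ) ℤ.- 1ℤ) ℤ.* x ℤ.+ q ≡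
      (m ℤ.* x ℤ.+ q ℤ.- 1ℤ) ℤ.* (1ℤ ℤ.+ u ℤ.* x) ℤ.- x ℤ.+ 1ℤ
    identity = solve-∀
  Q-first (suc n) = Q-3 , (begin
    a (4 + w) ℤ.* Q a (3 + w) ℤ.+ Q a (2 + w)
      ≡⟨ cong₂ ℤ._+_ (cong₂ ℤ._*_ (a-3 n) Q-3) (Q₂ n) ⟩
    (u (2 + n) ℤ.* y (suc n) ℤ.- 1ℤ) ℤ.* x (2 + n) ℤ.+ (y (suc n) ℤ.+ 1ℤ)
      ≡⟨ identity₄ (u (2 + n)) (x (2 + n)) (y (suc n)) ⟩
    y (suc n) ℤ.* (1ℤ ℤ.+ u (2 + n) ℤ.* x (2 + n)) ℤ.- x (2 + n) ℤ.+ 1ℤ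
      ≡⟨ cong (λ t → t ℤ.- x (2 + n) ℤ.+ 1ℤ) (sym (y-suc (suc n))) ⟩
    y (2 + n) ℤ.- x (2 + n) ℤ.+ 1ℤ ∎)
    where
    open ≡-Reasoning
    w = thrice n + K
    identity₃ : ∀ x y → (x ℤ.- 1ℤ) ℤ.* (y ℤ.+ 1ℤ) ℤ.+ (y ℤ.- x ℤ.+ 1ℤ) ≡ x ℤ.* y
    identity₃ = solve-∀
    identity₄ : ∀ u x y →
      (u ℤ.* y ℤ.- 1ℤ) ℤ.* x ℤ.+ (y ℤ.+ 1ℤ) ≡ y ℤ.* (1ℤ ℤ.+ u ℤ.* x) ℤ.- x ℤ.+ 1ℤ
    identity₄ = solve-∀
    Q-3 : Q a (3 + w) ≡ x (2 + n)
    Q-3 = begin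
      a (3 + w) ℤ.* Q a (2 + w) ℤ.+ Q a (1 + w)
        ≡⟨ cong₂ ℤ._+_ (cong₂ ℤ._*_ (a-2 n) (Q₂ n)) (Q₁ n) ⟩
      (x (suc n) ℤ.- 1ℤ) ℤ.* (y (suc n) ℤ.+ 1ℤ) ℤ.+ (y (suc n) ℤ.- x (suc n) ℤ.+ 1ℤ)
        ≡⟨ identity₃ (x (suc n)) (y (suc n)) ⟩
      x (suc n) ℤ.* y (suc n)
        ≡⟨ sym (x-suc n) ⟩
      x (2 + n) ∎

  Q₂ n = trans (cong₂ ℤ._+_ (cong₂ ℤ._*_ (a-1 n) (Q₁ n)) (Q₀ n))
    (identity (x (suc n)) (y (suc n)))
    where
    identity : ∀ x y → 1ℤ ℤ.* (y ℤ.- x ℤ.+ 1ℤ) ℤ.+ x ≡ y ℤ.+ 1ℤ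
    identity = solve-∀

  -- The index K is odd, which is why an expansion of p/q with odd last index is chosen. Each period
  -- adds three factors -1, that is, one change of sign, in step with the alternating series.
  sign : ∀ n → -1ℤ ℤ.^ (thrice n + K) ≡ -1ℤ ℤ.^ suc n
  sign zero    = cong (-1ℤ ℤ.*_) (trans (sym (ℤ.^-*-assoc -1ℤ 2 k)) (ℤ.^-zeroˡ k))
  sign (suc n) = trans (identity (-1ℤ ℤ.^ (thrice n + K))) (cong (-1ℤ ℤ.*_) (sign n))
    where
    identity : ∀ s → -1ℤ ℤ.* (-1ℤ ℤ.* (-1ℤ ℤ.* s)) ≡ -1ℤ ℤ.* s
    identity = solve-∀

  -- Convergence of the series and of the continued fraction

  h : ℕ → ℚ
  h n = recip (fromℤ (x (suc n)))

  vanishing : Vanishing h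
  vanishing ε 0<ε = ↧ₙ ε , λ n N≤n → recip-< 0<ε (ℤ.≤-<-trans (ℤ.+≤+ N≤n) (n<x n))

  -- The factor y from one `x` to the next is at least 2.
  h-halving : ∀ n → h (suc n) ℚ.+ h (suc n) ℚ.≤ h n
  h-halving n = *≤1⇒≤recip (0<x n) (begin
    (h (suc n) ℚ.+ h (suc n)) ℚ.* fromℤ (x (suc n))
      ≡⟨ identity (h (suc n)) (fromℤ (x (suc n))) ⟩
    h (suc n) ℚ.* (fromℤ (x (suc n)) ℚ.+ fromℤ (x (suc n)))
      ≡⟨ cong (h (suc n) ℚ.*_) (sym (fromℤ-+ (x (suc n)) (x (suc n)))) ⟩
    h (suc n) ℚ.* fromℤ (x (suc n) ℤ.+ x (suc n))
      ≤⟨ ℚ.*-monoˡ-≤-nonNeg (h (suc n)) {{ℚ.nonNegative (recip-nonNeg (0<x (suc n)))}}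
           (fromℤ-mono-≤ (subst (_ ℤ.≤_) (sym (x-suc n)) (x+x≤xy (ℤ.<⇒≤ (0<x n)) (1<y n)))) ⟩
    h (suc n) ℚ.* fromℤ (x (2 + n))
      ≡⟨ recip-fromℤ (0<x (suc n)) ⟩
    1ℚ ∎)
    where
    open ℚ.≤-Reasoning
    open +-*-Solver
    identity : ∀ s t → (s ℚ.+ s) ℚ.* t ≡ s ℚ.* (t ℚ.+ t)
    identity = solve 2 (λ s t → (s :+ s) :* t := s :* (t :+ t)) refl

  ∣term∣ : ∀ n → ℚ.∣ term x (2 + n) ∣ ≡ h (suc n)
  ∣term∣ n = begin
    ℚ.∣ fromℤ (-1ℤ ℤ.^ (2 + n)) ℚ.* h (suc n) ∣
      ≡⟨ ∣p*q∣≡∣p∣*q (fromℤ (-1ℤ ℤ.^ (2 + n))) (recip-nonNeg (0<x (suc n))) ⟩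
    ℚ.∣ fromℤ (-1ℤ ℤ.^ (2 + n)) ∣ ℚ.* h (suc n)
      ≡⟨ cong (ℚ._* h (suc n)) (trans (∣fromℤ∣ (-1ℤ ℤ.^ (2 + n)))
           (cong (fromℤ ∘ ℤ.+_) (∣-1^n∣≡1 (2 + n)))) ⟩
    1ℚ ℚ.* h (suc n)
      ≡⟨ ℚ.*-identityˡ (h (suc n)) ⟩
    h (suc n) ∎
    where open ≡-Reasoning

  cf-step : ∀ n → cf a (thrice (suc n) + K) ℚ.- cf a (thrice n + K) ≡ ℚ.- term x (2 + n)
  cf-step n = begin
    z
      ≡⟨ sym (ℚ.*-identityʳ z) ⟩
    z ℚ.* 1ℚ
      ≡⟨ cong (z ℚ.*_) (sym (trans (ℚ.*-comm (fromℤ x′) (h (suc n)))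
           (recip-fromℤ (0<x (suc n))))) ⟩
    z ℚ.* (fromℤ x′ ℚ.* h (suc n))
      ≡⟨ sym (ℚ.*-assoc z (fromℤ x′) (h (suc n))) ⟩
    z ℚ.* fromℤ x′ ℚ.* h (suc n)
      -- The product of the two denominators is x₀ x′ and the determinant is x₀ e, so cancelling x₀
      -- leaves e / x′.
      ≡⟨ cong (ℚ._* h (suc n)) (*-cancelˡ-≡ {fromℤ x₀} (fromℤ≢0 (0<x n)) cleared) ⟩
    fromℤ e ℚ.* h (suc n)
      ≡⟨ cong (λ s → fromℤ s ℚ.* h (suc n)) (identity e) ⟩
    fromℤ (ℤ.- (-1ℤ ℤ.* e)) ℚ.* h (suc n)
      ≡⟨ cong (ℚ._* h (suc n)) (fromℤ-neg (-1ℤ ℤ.* e)) ⟩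
    ℚ.- fromℤ (-1ℤ ℤ.* e) ℚ.* h (suc n)
      ≡⟨ sym (ℚ.neg-distribˡ-* (fromℤ (-1ℤ ℤ.* e)) (h (suc n))) ⟩
    ℚ.- term x (2 + n) ∎
    where
    open ≡-Reasoning
    w  = thrice n + K
    z  = cf a (3 + w) ℚ.- cf a w
    e  = -1ℤ ℤ.^ suc n
    x₀ = x (suc n)
    x′ = x (2 + n)
    identity : ∀ e → e ≡ ℤ.- (-1ℤ ℤ.* e)
    identity = solve-∀
    identity′ : ∀ x → (x ℤ.- 1ℤ) ℤ.* 1ℤ ℤ.+ 1ℤ ≡ x
    identity′ = solve-∀
    swap : ∀ r s t → s ℚ.* (r ℚ.* t) ≡ r ℚ.* (s ℚ.* t)
    swap = solve 3 (λ r s t → s :* (r :* t) := r :* (s :* t)) refl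
      where open +-*-Solver
    cleared : fromℤ x₀ ℚ.* (z ℚ.* fromℤ x′) ≡ fromℤ x₀ ℚ.* fromℤ e
    cleared = begin
      fromℤ x₀ ℚ.* (z ℚ.* fromℤ x′)
        ≡⟨ swap z (fromℤ x₀) (fromℤ x′) ⟩
      z ℚ.* (fromℤ x₀ ℚ.* fromℤ x′)
        ≡⟨ cong₂ (λ s t → z ℚ.* (fromℤ s ℚ.* fromℤ t)) (sym (Q₀ n)) (sym (Q₀ (suc n))) ⟩
      z ℚ.* (fromℤ (Q a w) ℚ.* fromℤ (Q a (3 + w)))
        ≡⟨ fraction-difference (cf a w) (cf a (3 + w))
             (P a w) (Q a w) (P a (3 + w)) (Q a (3 + w))
             (cf-fraction w (admissible w (nondegenerate₀ n)))
             (cf-fraction (3 + w) (admissible (3 + w) (nondegenerate₀ (suc n)))) ⟩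
      fromℤ (P a (3 + w) ℤ.* Q a w ℤ.- P a w ℤ.* Q a (3 + w))
        ≡⟨ cong fromℤ (P-Q-determinant₃ a w) ⟩
      fromℤ ((a (3 + w) ℤ.* a (2 + w) ℤ.+ 1ℤ) ℤ.* -1ℤ ℤ.^ w)
        ≡⟨ cong fromℤ (cong₂ ℤ._*_
             (trans (cong₂ (λ s t → s ℤ.* t ℤ.+ 1ℤ) (a-2 n) (a-1 n)) (identity′ x₀)) (sign n)) ⟩
      fromℤ (x₀ ℤ.* e)
        ≡⟨ fromℤ-* x₀ e ⟩
      fromℤ x₀ ℚ.* fromℤ e ∎

  series : ℕ → ℚ
  series n = p/q ℚ.- sumFrom2 (term x) n

  series-step : ∀ n → series (suc n) ≡ series n ℚ.- term x (2 + n)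
  series-step n = identity p/q (sumFrom2 (term x) n) (term x (2 + n))
    where
    open +-*-Solver
    identity : ∀ r s t → r ℚ.- (s ℚ.+ t) ≡ r ℚ.- s ℚ.- t
    identity = solve 3 (λ r s t → r :- (s :+ t) := r :- s :- t) refl

  series≡cf : ∀ n → series n ≡ cf a (thrice n + K)
  series≡cf zero    = trans (ℚ.+-identityʳ p/q) (trans p/q≡ (sym (cf-cong K a-prefix)))
  series≡cf (suc n) = begin
    series (suc n)
      ≡⟨ series-step n ⟩
    series n ℚ.- term x (2 + n)
      ≡⟨ cong₂ ℚ._+_ (series≡cf n) (sym (cf-step n)) ⟩
    cf a (thrice n + K) ℚ.+ (cf a (thrice (suc n) + K) ℚ.- cf a (thrice n + K))
      ≡⟨ identity (cf a (thrice n + K)) (cf a (thrice (suc n) + K)) ⟩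
    cf a (thrice (suc n) + K) ∎
    where
    open ≡-Reasoning
    identity : ∀ r s → r ℚ.+ (s ℚ.- r) ≡ s
    identity = solve 2 (λ r s → r :+ (s :- r) := s) refl
      where open +-*-Solver

  series-steps : ∀ n → ℚ.∣ series (suc n) ℚ.- series n ∣ ℚ.≤ h (suc n)
  series-steps n = ℚ.≤-reflexive (begin
    ℚ.∣ series (suc n) ℚ.- series n ∣
      ≡⟨ cong (λ s → ℚ.∣ s ℚ.- series n ∣) (series-step n) ⟩
    ℚ.∣ series n ℚ.- term x (2 + n) ℚ.- series n ∣
      ≡⟨ cong ℚ.∣_∣ (identity (series n) (term x (2 + n))) ⟩
    ℚ.∣ ℚ.- term x (2 + n) ∣
      ≡⟨ ℚ.∣-p∣≡∣p∣ (term x (2 + n)) ⟩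
    ℚ.∣ term x (2 + n) ∣
      ≡⟨ ∣term∣ n ⟩
    h (suc n) ∎)
    where
    open ≡-Reasoning
    identity : ∀ s t → s ℚ.- t ℚ.- s ≡ ℚ.- t
    identity = solve 2 (λ s t → s :- t :- s := :- t) refl
      where open +-*-Solver

  series-convergent : ∃[ α ] (series ⟶ α)
  series-convergent = convergent {S = series} {h = h}
    (λ n → recip-nonNeg (0<x n)) series-steps h-halving vanishing

  unimodular-close : ∀ n i →
    ¬ Degenerate k m (u 1) q₂ₖ i →
    ∣ P a i ℤ.* Q a (thrice n + K) ℤ.- P a (thrice n + K) ℤ.* Q a i ∣ ≡ 1 →
    ℚ.∣ cf a i ℚ.- series n ∣ ℚ.≤ h n
  unimodular-close n i nondeg unimodular = subst₂ (λ s t → ℚ.∣ cf a i ℚ.- s ∣ ℚ.≤ recip (fromℤ t))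
    (sym (series≡cf n)) (Q₀ n)
    (unimodular-distance (cf a w) (cf a i) (P a w) (Q a w) (P a i) (Q a i)
      (cf-fraction w admissible-w) (cf-fraction i admissible-i)
      (Q-positive w admissible-w) (Q-positive i admissible-i) unimodular)
    where
    w = thrice n + K
    admissible-w = admissible w (nondegenerate₀ n)
    admissible-i = admissible i nondeg

  -- The base cases are the three positions in a period: the partial sum itself, its neighbour, and
  -- the convergent two further on, where the entry 1 keeps the determinant unimodular. Starting at
  -- `suc n` skips the first period and with it the degenerate index.
  convergent-close : ∀ n t →
    ∃[ s ] (n ≤ s × ℚ.∣ cf a (t + (thrice (suc n) + K)) ℚ.- series s ∣ ℚ.≤ h s)
  convergent-close n zero = suc n , ℕ.n≤1+n n ,
    subst (λ r → ℚ.∣ r ℚ.- series (suc n) ∣ ℚ.≤ h (suc n)) (series≡cf (suc n))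
      (subst (λ r → ℚ.∣ r ∣ ℚ.≤ h (suc n)) (sym (ℚ.+-inverseʳ (series (suc n))))
        (recip-nonNeg (0<x (suc n))))
  convergent-close n (suc zero) = suc n , ℕ.n≤1+n n ,
    unimodular-close (suc n) (1 + (thrice (suc n) + K)) (nondegenerate (1 + thrice (suc n)) λ ())
      (trans (cong ∣_∣ (P-Q-determinant a w)) (∣-1^n∣≡1 w))
    where w = thrice (suc n) + K
  convergent-close n (suc (suc zero)) = suc n , ℕ.n≤1+n n ,
    unimodular-close (suc n) (2 + (thrice (suc n) + K)) (nondegenerate₂ (suc n))
      (trans (cong ∣_∣ (trans (P-Q-determinant₂ a w)
        (trans (cong (ℤ._* -1ℤ ℤ.^ w) (a-1 (suc n))) (ℤ.*-identityˡ (-1ℤ ℤ.^ w))))) (∣-1^n∣≡1 w))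
    where w = thrice (suc n) + K
  convergent-close n (suc (suc (suc t))) with convergent-close (suc n) t
  ... | s , n<s , close = s , ℕ.<⇒≤ n<s ,
    subst (λ i → ℚ.∣ cf a i ℚ.- series s ∣ ℚ.≤ h s) (shift t (thrice (suc n) + K)) close
    where
    shift : ∀ t w → t + (3 + w) ≡ 3 + (t + w)
    shift t w = trans (ℕ.+-suc t (2 + w)) (cong suc
      (trans (ℕ.+-suc t (suc w)) (cong suc (ℕ.+-suc t w))))

  cf⟶ : ∀ α → series ⟶ α → cf a ⟶ α
  cf⟶ α = ⟶-close {S = series} {h = h} {r = cf a} {α = α} vanishing
    λ n → thrice (suc n) + K , λ i M≤i →
    subst (λ i → ∃[ s ] (n ≤ s × ℚ.∣ cf a i ℚ.- series s ∣ ℚ.≤ h s))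
      (ℕ.m∸n+n≡m M≤i) (convergent-close n (i ∸ (thrice (suc n) + K)))

  -- Passage to the indices of the statement

  ↧₀ : ∀ n → ↧ (cf a (thrice n + K)) ≡ x (suc n)
  ↧₀ n = trans (↧-cf (thrice n + K) (admissible (thrice n + K) (nondegenerate₀ n))) (Q₀ n)

  ↧₁ : ∀ n → ¬ Degenerate k m (u 1) q₂ₖ (1 + (thrice n + K)) →
       ↧ (cf a (1 + (thrice n + K))) ≡ y (suc n) ℤ.- x (suc n) ℤ.+ 1ℤ
  ↧₁ n nondeg = trans (↧-cf (1 + (thrice n + K)) (admissible (1 + (thrice n + K)) nondeg)) (Q₁ n)

  ↧₂ : ∀ n → ↧ (cf a (2 + (thrice n + K))) ≡ y (suc n) ℤ.+ 1ℤ
  ↧₂ n = trans (↧-cf (2 + (thrice n + K)) (admissible (2 + (thrice n + K)) (nondegenerate₂ n))) (Q₂ n)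

  -- The statement numbers periods from j = n + 1 and refers to 2k + 3j, the third position of a
  -- period; subtracting 2 and 1 reaches the other two.
  index : ∀ n → 2 * k + 3 * suc n ≡ 2 + (thrice n + K)
  index n = begin
    2 * k + 3 * suc n        ≡⟨ cong (2 * k +_) (sym (thrice≡3* (suc n))) ⟩
    2 * k + (3 + thrice n)   ≡⟨ ℕ.+-comm (2 * k) (3 + thrice n) ⟩
    3 + (thrice n + 2 * k)   ≡⟨ cong (2 +_) (sym (ℕ.+-suc (thrice n) (2 * k))) ⟩
    2 + (thrice n + K)       ∎
    where open ≡-Reasoning

  index+ : ∀ n i → 2 * k + 3 * suc n + i ≡ i + (2 + (thrice n + K))
  index+ n i = trans (ℕ.+-comm (2 * k + 3 * suc n) i) (cong (i +_) (index n))

  quotients : ∀ j → 1 ≤ j →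
    (a (2 * k + 3 * j) ≡ 1ℤ) ×
    (a (2 * k + 3 * j + 1) ≡ x j ℤ.- 1ℤ) ×
    (a (2 * k + 3 * j + 2) ≡ u (j + 1) ℤ.* y j ℤ.- 1ℤ)
  quotients (suc n) _ =
      trans (cong a (index n)) (a-1 n)
    , trans (cong a (index+ n 1)) (a-2 n)
    , trans (cong a (index+ n 2)) (trans (a-3 n)
        (cong (λ i → u i ℤ.* y (suc n) ℤ.- 1ℤ) (ℕ.+-comm 1 (suc n))))

  denominators : ∀ j → 1 ≤ j →
    (↧ (cf a (2 * k + 3 * j ∸ 2)) ≡ x j) ×
    (¬ Degenerate k m (u 1) q₂ₖ (2 * k + 3 * j ∸ 1) →
      ↧ (cf a (2 * k + 3 * j ∸ 1)) ≡ y j ℤ.- x j ℤ.+ 1ℤ) ×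
    (↧ (cf a (2 * k + 3 * j)) ≡ y j ℤ.+ 1ℤ)
  denominators (suc n) _ =
      trans (cong (λ i → ↧ (cf a (i ∸ 2))) (index n)) (↧₀ n)
    , subst (λ i → ¬ Degenerate k m (u 1) q₂ₖ (i ∸ 1) →
                   ↧ (cf a (i ∸ 1)) ≡ y (suc n) ℤ.- x (suc n) ℤ.+ 1ℤ) (sym (index n)) (↧₁ n)
    , trans (cong (↧_ ∘ cf a) (index n)) (↧₂ n)

theorem2p4 :
  -- p / q in lowest terms, q = ↧ p/q
  (p/q : ℚ) (m : ℤ) → 0ℤ ℤ.≤ m →
  (u : ℕ → ℤ) → (∀ n → 1 ≤ n → 0ℤ ℤ.< u n) →
  -- p / q = [c 0; c 1, …, c (2k+1)]
  (k : ℕ) (c : ℕ → ℤ) →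
  (∀ j → 1 ≤ j → j ≤ 2 * k + 1 → 0ℤ ℤ.< c j) →
  p/q ≡ cf c (2 * k + 1) →
  let q = ↧ p/q
      q₂ₖ = ↧ (cf c (2 * k)) in
  1ℤ ℤ.< q →
  (q₂ₖ ≡ 1ℤ → 1ℤ ℤ.≤ m) →
  (x y : ℕ → ℤ) →
  x 1 ≡ q →
  y 0 ≡ m ℤ.* q ℤ.+ q₂ₖ ℤ.- 1ℤ →
  (∀ j → 1 ≤ j → y j ≡ y (j ∸ 1) ℤ.* (1ℤ ℤ.+ u j ℤ.* x j)) →
  (∀ j → 1 ≤ j → x (suc j) ≡ x j ℤ.* y j) →
  let series = λ n → p/q ℚ.- sumFrom2 (term x) n in
  (∃[ α ] (series ⟶ α)) ×
  (∀ α → series ⟶ α →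
    ∃[ a ] (
      -- α = [a 0; a 1, a 2, …]
      (∀ j → 1 ≤ j → ¬ Degenerate k m (u 1) q₂ₖ j → 0ℤ ℤ.< a j) ×
      (cf a ⟶ α) ×
      -- the partial quotients
      (∀ j → j ≤ 2 * k + 1 → a j ≡ c j) ×
      (a (2 * k + 2) ≡ m ℤ.+ u 1 ℤ.* y 0 ℤ.- 1ℤ) ×
      (∀ j → 1 ≤ j →
        (a (2 * k + 3 * j) ≡ 1ℤ) ×
        (a (2 * k + 3 * j + 1) ≡ x j ℤ.- 1ℤ) ×
        (a (2 * k + 3 * j + 2) ≡ u (j + 1) ℤ.* y j ℤ.- 1ℤ)) ×
      -- the denominators of the convergents
      (∀ j → 1 ≤ j →
        (↧ (cf a (2 * k + 3 * j ∸ 2)) ≡ x j) ×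
        (¬ Degenerate k m (u 1) q₂ₖ (2 * k + 3 * j ∸ 1) →
          ↧ (cf a (2 * k + 3 * j ∸ 1)) ≡ y j ℤ.- x j ℤ.+ 1ℤ) ×
        (↧ (cf a (2 * k + 3 * j)) ≡ y j ℤ.+ 1ℤ))))
theorem2p4 p/q m 0≤m u 0<u k c 0<c p/q≡ 1<q q₂ₖ≡1⇒1≤m x y x₁≡ y₀≡ y≡ x≡ =
  series-convergent , λ α series⟶α →
    a , a-positive , cf⟶ α series⟶α ,
    (λ j j≤ → a-prefix j (subst (j ≤_) 2k+1≡K j≤)) ,
    trans (cong a (ℕ.+-comm (2 * k) 2)) a-first ,
    quotients , denominators
  where
  2k+1≡K : 2 * k + 1 ≡ suc (2 * k)
  2k+1≡K = ℕ.+-comm (2 * k) 1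
  0<c′ : ∀ j → 1 ≤ j → j ≤ suc (2 * k) → 0ℤ ℤ.< c j
  0<c′ j 1≤j j≤ = 0<c j 1≤j (subst (j ≤_) (sym 2k+1≡K) j≤)
  p/q≡′ : p/q ≡ cf c (suc (2 * k))
  p/q≡′ = trans p/q≡ (cong (cf c) 2k+1≡K)
  -- Admissibility lets `↧` be replaced by `Q` at 2k and 2k + 1. For k = 0 the shorter segment is
  -- `c 0` alone, of arbitrary sign, which is why `last` has the premise `1 ≤ n`.
  c-admissible : ∀ n → n ≤ suc (2 * k) → Admissible c n
  c-admissible n n≤ .inner j 1≤j j≤n = ℤ.<⇒≤ (0<c′ j 1≤j (ℕ.≤-trans j≤n n≤))
  c-admissible n n≤ .last 1≤n = 0<c′ n 1≤n n≤
  admissible-2k : Admissible c (2 * k)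
  admissible-2k = c-admissible (2 * k) (ℕ.n≤1+n _)
  q₂ₖ≡ : ↧ (cf c (2 * k)) ≡ Q c (2 * k)
  q₂ₖ≡ = ↧-cf (2 * k) admissible-2k
  open Expansion p/q m (↧ (cf c (2 * k))) u k c x y 0≤m 0<u 0<c′ p/q≡′
    q₂ₖ≡ (subst (0ℤ ℤ.<_) (sym q₂ₖ≡) (Q-positive (2 * k) admissible-2k)) q₂ₖ≡1⇒1≤m
    (subst (1ℤ ℤ.<_) (sym x₁≡) 1<q)
    (trans x₁≡ (trans (cong ↧_ p/q≡′)
      (↧-cf (suc (2 * k)) (c-admissible (suc (2 * k)) ℕ.≤-refl))))
    (trans y₀≡ (cong (λ q → m ℤ.* q ℤ.+ ↧ (cf c (2 * k)) ℤ.- 1ℤ) (sym x₁≡)))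
    y≡ x≡
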